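{- For all $n,k\in\mathbb{N}$, $T(n,\omega\cdot k)\ge k^{n}$. Consequently $T(n,\omega\cdot k)=k^{n}$.
   Context: $\mathbb{N}=\{0,1,2,\dots\}$ and $[c]=\{1,\dots,c\}$; the convention $0^0=1$ is used. Each ordinal $\alpha$ is identified with the linearly ordered set of ordinals $\beta<\alpha$; $\omega\cdot k$ is the concatenation of $k$ copies of $\omega$ (elements $\omega\cdot b+a$ with $0\le b<k$, $a\in\mathbb{N}$). $\binom{S}{n}$ is the set of $n$-element subsets of $S$. $\approx$ denotes order-equivalence (existence of an order-preserving bijection). For a linearly ordered set $S$ and $n\in\mathbb{N}$, $T(n,S)$ is the least $t\in\mathbb{N}$ such that for every $c\ge 1$ and every coloring $\mathrm{COL}:\binom{S}{n}\to[c]$ there exists $S'\subseteq S$ with $S'\approx S$ and $|\mathrm{COL}(\binom{S'}{n})|\le t$; if no such $t$ exists, $T(n,S)=\infty$. -}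

module Defs where

open import Axiom.ExcludedMiddle using (ExcludedMiddle)
open import Data.Fin.Base using (Fin)
import Data.Fin.Properties as Fin
open import Data.Fin.Subset as FinSubset using () renaming (∣_∣ to card)
open import Data.Nat.Base using (ℕ; _≤_)
import Data.Nat.Properties as ℕ
open import Data.Product.Base using (Σ-syntax; ∃; ∃-syntax; _×_; _,_; proj₁)
open import Data.Product.Relation.Binary.Lex.Strict using (×-strictTotalOrder)
import Data.Vec.Relation.Binary.Equality.Setoid as VecEquality
open import Data.Vec.Relation.Unary.All using (All)
open import Data.Vec.Relation.Unary.AllPairs using (AllPairs)
open import Function.Bundles using (Func; _⟶ₛ_; _⇔_)
open import Level using (0ℓ) renaming (suc to lsuc)
open import Relation.Binary.Bundles using (Setoid; StrictTotalOrder)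
import Relation.Binary.Construct.Add.Supremum.NonStrict as AddSupremum
import Relation.Binary.Construct.On as On
open import Relation.Binary.Morphism.Structures using (IsOrderIsomorphism)
open import Relation.Binary.PropositionalEquality using (_≡_)
import Relation.Binary.PropositionalEquality.Properties as ≡
open import Relation.Nullary.Construct.Add.Supremum using (_⁺; ⊤⁺; [_])
open import Relation.Nullary.Decidable.Core using (yes; no)
open import Relation.Unary using (Pred)

LinearOrder : Set₁
LinearOrder = StrictTotalOrder 0ℓ 0ℓ 0ℓ

-- The pair (b , a) stands for the ordinal ω · b + a.
ω·_ : ℕ → LinearOrder
ω· k = ×-strictTotalOrder (Fin.<-strictTotalOrder k) ℕ.<-strictTotalOrder

infix 4 _≅_

_≅_ : LinearOrder → LinearOrder → Set
A ≅ B = ∃[ f ] IsOrderIsomorphism A._≈_ B._≈_ A._<_ B._<_ f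
  where
  module A = StrictTotalOrder A
  module B = StrictTotalOrder B

module _ (S : LinearOrder) where
  open StrictTotalOrder S using (Carrier; _≈_; _<_; module Eq)

  record Subset : Set₁ where
    field
      member   : Pred Carrier 0ℓ
      respects : ∀ {x y} → x ≈ y → member x → member y

  open Subset

  restrict : Subset → LinearOrder
  restrict S′ = On.strictTotalOrder S (proj₁ {B = member S′})

  -- An n-element subset of a linear order is represented by the list of its
  -- elements in strictly increasing order; two such lists enumerate the same
  -- subset exactly when they agree pointwise.
  nSubsets : ℕ → Setoid 0ℓ 0ℓ
  nSubsets n = On.setoid (VecEquality.≋-setoid Eq.setoid n)
                         (proj₁ {B = AllPairs _<_})

  Coloring : ℕ → ℕ → Set
  Coloring n c = nSubsets n ⟶ₛ ≡.setoid (Fin c)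

  Attained : ∀ {n c} → Coloring n c → Subset → Fin c → Set
  Attained COL S′ x =
    ∃[ A ] All (member S′) (proj₁ A) × Func.to COL A ≡ x

  -- | COL (S′ choose n) | ≤ t
  AtMostColors : ∀ {n c} → Coloring n c → Subset → ℕ → Set
  AtMostColors {c = c} COL S′ t =
    Σ[ D ∈ FinSubset.Subset c ]
      (∀ x → (x FinSubset.∈ D) ⇔ Attained COL S′ x) × card D ≤ t

  Bound : ℕ → ℕ → Set₁
  Bound n t = ∀ c → 1 ≤ c → (COL : Coloring n c) →
    Σ[ S′ ∈ Subset ] (restrict S′ ≅ S) × AtMostColors COL S′ t

  LeastBound : ℕ → ℕ → Set₁
  LeastBound n t = Bound n t × (∀ u → Bound n u → t ≤ u)

ℕ∞ : Set
ℕ∞ = ℕ ⁺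

open AddSupremum _≤_ public using () renaming (_≤⁺_ to _≤∞_)

-- Excluded middle decides whether some t qualifies; the value is ⊤⁺ (that is,
-- ∞) when none does.
T : ExcludedMiddle (lsuc 0ℓ) → ℕ → LinearOrder → ℕ∞
T em n S with em {∃ (LeastBound S n)}
... | yes (t , _) = [ t ]
... | no  _       = ⊤⁺

{-# OPTIONS --safe #-}

-- An n-set in ω · k whose second coordinates are distinct amounts to these
-- coordinates a₁ < … < aₙ and the word b₁ … bₙ of the corresponding blocks.
--
-- Upper bound: colour {a₁ < … < aₙ} by the function sending each of the kⁿ words
-- to the colour of the corresponding n-set, and let h enumerate an infinite set
-- homogeneous for it (Ramsey).  The points (b , h (b + j · k)) form a copy of
-- ω · k with pairwise distinct second coordinates, on which the colour of an
-- n-set depends only on its word.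
--
-- Lower bound: colour an n-set by its word.  An embedding of ω · k into itself
-- maps every block into itself: points of different blocks at the same height
-- go to different blocks, because no block has room for an infinite increasing
-- sequence below one of its points, and a strictly increasing self-map of the
-- k blocks is the identity.  So every copy of ω · k is infinite in each block
-- and realizes all kⁿ words.
module Submission where

open import Defs
open import Axiom.ExcludedMiddle using (ExcludedMiddle)
open import Data.Bool.Base using (true)
open import Data.Fin.Base as Fin
  using (Fin; zero; suc; toℕ; fromℕ; inject₁; punchOut; finToFun; funToFin)
import Data.Fin.Induction as Fin
import Data.Fin.Properties as Fin
open import Data.Fin.Subset as FinSubset
  using (inside; outside; ⊤; ⊥; ⁅_⁆; _∪_; _⊆_) renaming (∣_∣ to card)
import Data.Fin.Subset.Properties as FinSubset
open import Data.List.Relation.Binary.Permutation.Propositional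
  using (_↭_; prep; swap; ↭-refl; ↭-sym; ↭-trans)
import Data.List.Relation.Binary.Permutation.Propositional.Properties as ↭
import Data.List.Relation.Unary.All as ListAll
open import Data.List.Relation.Unary.Any using (here; there)
open import Data.Nat.Base
  using (ℕ; zero; suc; _+_; _*_; _^_; _≤_; _<_; _<′_; z≤n; s≤s; z<s; s<s; s≤s⁻¹; s<s⁻¹; <′-base; ≤′-step)
import Data.Nat.Properties as ℕ
open import Data.Product.Base using (Σ-syntax; ∃; ∃₂; _×_; _,_; proj₁; proj₂)
open import Data.Product.Relation.Binary.Pointwise.NonDependent using (≡×≡⇒≡; ≡⇒≡×≡)
open import Data.Sum.Base using (_⊎_; inj₁; inj₂)
open import Data.Vec.Base as Vec using (Vec; []; _∷_; map; zip; toList; lookup; tabulate)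
import Data.Vec.Properties as Vec
open import Data.Vec.Relation.Binary.Pointwise.Inductive using (Pointwise-≡⇒≡)
import Data.Vec.Relation.Binary.Pointwise.Inductive as Pointwise
open import Data.Vec.Relation.Unary.All as All using (All; []; _∷_)
import Data.Vec.Relation.Unary.All.Properties as All
open import Data.Vec.Relation.Unary.AllPairs as AllPairs using (AllPairs; []; _∷_)
import Data.Vec.Relation.Unary.AllPairs.Properties as AllPairs
open import Function.Base using (_∘_; _on_; id)
open import Function.Bundles using (Func; _⇔_; mk⇔; Equivalence)
open import Level using (0ℓ; lift; lower) renaming (suc to lsuc)
open import Relation.Binary.Bundles using (StrictTotalOrder)
open import Relation.Binary.Core using (Rel)
open import Relation.Binary.Definitions using (Asymmetric; tri<; tri≈; tri>)
import Relation.Binary.Construct.On as On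
open import Relation.Binary.Morphism.Structures using (IsOrderIsomorphism)
open import Relation.Binary.PropositionalEquality
  using (_≡_; _≢_; refl; sym; trans; cong; cong₂; subst; subst₂; module ≡-Reasoning)
import Relation.Binary.Construct.Add.Supremum.NonStrict as AddSupremum
open import Relation.Nullary.Construct.Add.Supremum using ([_])
open import Relation.Nullary.Decidable.Core using (yes; no; does; map′)
open import Relation.Nullary.Negation.Core using (¬_; contradiction)
open import Relation.Unary using (Pred)

private
  variable
    A B : Set
    c k m n : ℕ

-- Vectors up to rearrangement, and sorting

preimage : (f : A → B) {v : Vec B n} → All (λ y → ∃ λ x → f x ≡ y) v →
           ∃ λ u → map f u ≡ v
preimage f []                = [] , refl
preimage f ((x , eq) ∷ rest) with u , eqs ← preimage f rest =
  x ∷ u , cong₂ _∷_ eq eqs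

map⁻ : {R : Rel B 0ℓ} {f : A → B} {v : Vec A n} →
       AllPairs R (map f v) → AllPairs (R on f) v
map⁻ {v = []}    []           = []
map⁻ {v = _ ∷ _} (rx ∷ rxs) = All.map⁻ rx ∷ map⁻ rxs

irrefl⇒distinct : {R : Rel A 0ℓ} → (∀ {x} → ¬ R x x) → {v : Vec A n} →
                  AllPairs R v → AllPairs _≢_ v
irrefl⇒distinct irrefl = AllPairs.map λ where xRx refl → irrefl xRx

infix 4 _~_

-- Sets are listed in the order `_≺_`, while words are read by increasing second coordinate; this
-- relation passes between the two listings.
_~_ : Rel (Vec A n) 0ℓ
u ~ v = toList u ↭ toList v

All-resp-~ : {P : Pred A 0ℓ} {u v : Vec A n} → u ~ v → All P u → All P v
All-resp-~ u~v = All.toList⁻ ∘ ↭.All-resp-↭ u~v ∘ All.toList⁺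

map-~ : (f : A → B) {u v : Vec A n} → u ~ v → map f u ~ map f v
map-~ f {u} {v} u~v =
  subst₂ _↭_ (sym (Vec.toList-map f u)) (sym (Vec.toList-map f v)) (↭.map⁺ f u~v)

-- If each head sat in the other tail, each would be `R`-below the other.
least-unique : {R : Rel A 0ℓ} → Asymmetric R → {x y : A} {u v : Vec A n} →
               All (R x) u → All (R y) v → x ∷ u ~ y ∷ v → x ≡ y
least-unique asym x<u y<v p
  with ↭.∈-resp-↭ p (here refl) | ↭.∈-resp-↭ (↭-sym p) (here refl)
... | here x≡y  | _         = x≡y
... | there _   | here y≡x  = sym y≡x
... | there x∈v | there y∈u =
  contradiction (ListAll.lookup (All.toList⁺ y<v) x∈v)
                (asym (ListAll.lookup (All.toList⁺ x<u) y∈u))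

-- Makes the choice in `symmetrize` unambiguous. `R` may leave distinct elements incomparable, as
-- the comparison of second coordinates does.
sorted-unique : {R : Rel A 0ℓ} → Asymmetric R → {u v : Vec A n} →
                AllPairs R u → AllPairs R v → u ~ v → u ≡ v
sorted-unique asym [] [] _ = refl
sorted-unique asym {x ∷ u} {y ∷ v} (x<u ∷ u↗) (y<v ∷ v↗) p
  with refl ← least-unique asym {u = u} {v = v} x<u y<v p
  = cong (x ∷_) (sorted-unique asym u↗ v↗ (↭.drop-∷ p))

module Sorting (O : StrictTotalOrder 0ℓ 0ℓ 0ℓ) where
  open StrictTotalOrder O renaming (Carrier to X; _<_ to _≺_; trans to ≺-trans)

  insert : (x : X) (v : Vec X n) → All (λ y → ¬ x ≈ y) v → AllPairs _≺_ v →
           Σ[ u ∈ Vec X (suc n) ] u ~ x ∷ v × AllPairs _≺_ u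
  insert x [] [] [] = x ∷ [] , ↭-refl , [] ∷ []
  insert x (y ∷ v) (x≉y ∷ x≉v) (y≺v ∷ v↗) with compare x y
  ... | tri< x≺y _ _ =
    x ∷ y ∷ v , ↭-refl , (x≺y ∷ All.map (≺-trans x≺y) y≺v) ∷ y≺v ∷ v↗
  ... | tri≈ _ x≈y _ = contradiction x≈y x≉y
  ... | tri> _ _ y≺x with u , u~xv , u↗ ← insert x v x≉v v↗ =
    y ∷ u , ↭-trans (prep y u~xv) (swap y x ↭-refl) ,
    All-resp-~ {u = x ∷ v} {v = u} (↭-sym u~xv) (y≺x ∷ y≺v) ∷ u↗

  sort : (v : Vec X n) → AllPairs (λ x y → ¬ x ≈ y) v →
         Σ[ u ∈ Vec X n ] u ~ v × AllPairs _≺_ u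
  sort []      []          = [] , ↭-refl , []
  sort (x ∷ v) (x≉v ∷ v≉) with u , u~v , u↗ ← sort v v≉
    with w , w~xu , w↗ ← insert x u (All-resp-~ {u = v} {v = u} (↭-sym u~v) x≉v) u↗ =
    w , ↭-trans w~xu (prep x u~v) , w↗

-- Words coded as numbers, and sizes of finite sets

encode : Vec (Fin k) n → Fin (k ^ n)
encode v = funToFin (lookup v)

decode : Fin (k ^ n) → Vec (Fin k) n
decode i = tabulate (finToFun i)

decode∘encode : (v : Vec (Fin k) n) → decode (encode v) ≡ v
decode∘encode v =
  trans (Vec.tabulate-cong (Fin.finToFun-funToFin (lookup v))) (Vec.tabulate∘lookup v)

funToFin-cong : {f g : Fin m → Fin n} → (∀ i → f i ≡ g i) → funToFin f ≡ funToFin g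
funToFin-cong {zero}  eq = refl
funToFin-cong {suc m} eq = cong₂ Fin.combine (eq zero) (funToFin-cong (eq ∘ suc))

encode∘decode : (i : Fin (k ^ n)) → encode (decode {k} {n} i) ≡ i
encode∘decode {k} {n} i = trans
  (funToFin-cong (Vec.lookup∘tabulate (finToFun {k} {n} i)))
  (Fin.funToFin-finToFin {n} {k} i)

∣p∪q∣≤∣p∣+∣q∣ : (p q : FinSubset.Subset n) → card (p ∪ q) ≤ card p + card q
∣p∪q∣≤∣p∣+∣q∣ []            []            = z≤n
∣p∪q∣≤∣p∣+∣q∣ (outside ∷ p) (outside ∷ q) = ∣p∪q∣≤∣p∣+∣q∣ p q
∣p∪q∣≤∣p∣+∣q∣ (outside ∷ p) (inside ∷ q)  =
  ℕ.≤-trans (s≤s (∣p∪q∣≤∣p∣+∣q∣ p q)) (ℕ.≤-reflexive (sym (ℕ.+-suc (card p) (card q))))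
∣p∪q∣≤∣p∣+∣q∣ (inside ∷ p)  (outside ∷ q) = s≤s (∣p∪q∣≤∣p∣+∣q∣ p q)
∣p∪q∣≤∣p∣+∣q∣ (inside ∷ p)  (inside ∷ q)  =
  -- A common element counts once on the left and twice on the right.
  s≤s (ℕ.≤-trans (∣p∪q∣≤∣p∣+∣q∣ p q) (ℕ.+-monoʳ-≤ (card p) (ℕ.n≤1+n _)))

image : (Fin m → Fin n) → FinSubset.Subset n
image {zero}  f = ⊥
image {suc m} f = ⁅ f zero ⁆ ∪ image (f ∘ suc)

∈-image : (f : Fin m → Fin n) (i : Fin m) → f i FinSubset.∈ image f
∈-image f zero    = FinSubset.x∈p∪q⁺ (inj₁ (FinSubset.x∈⁅x⁆ (f zero)))
∈-image f (suc i) = FinSubset.x∈p∪q⁺ (inj₂ (∈-image (f ∘ suc) i))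

∣image∣≤ : (f : Fin m → Fin n) → card (image f) ≤ m
∣image∣≤ {zero}  {n} f = ℕ.≤-reflexive (FinSubset.∣⊥∣≡0 n)
∣image∣≤ {suc m} f = ℕ.≤-trans (∣p∪q∣≤∣p∣+∣q∣ ⁅ f zero ⁆ (image (f ∘ suc)))
  (ℕ.+-mono-≤ (ℕ.≤-reflexive (FinSubset.∣⁅x⁆∣≡1 (f zero))) (∣image∣≤ (f ∘ suc)))

-- Ramsey's theorem on the natural numbers

StrictMono : (ℕ → ℕ) → Set
StrictMono h = ∀ {i j} → i < j → h i < h j

step⇒StrictMono : {h : ℕ → ℕ} → (∀ i → h i < h (suc i)) → StrictMono h
step⇒StrictMono {h} step {i} i<j = go (ℕ.<⇒<′ i<j)
  where
  go : ∀ {j} → i <′ j → h i < h j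
  go <′-base       = step i
  go (≤′-step i<j) = ℕ.<-trans (go i<j) (step _)

Increasing : Vec ℕ n → Set
Increasing = AllPairs _<_

map-Increasing : {h : ℕ → ℕ} → StrictMono h → {v : Vec ℕ n} →
                 Increasing v → Increasing (map h v)
map-Increasing mono = AllPairs.map⁺ ∘ AllPairs.map mono

-- The homogeneous set is given by its increasing enumeration `h`, so that passing to an infinite
-- subset is composition.
Homogeneous : (Vec ℕ n → A) → Set
Homogeneous f = ∃₂ λ h x → StrictMono h × (∀ v → Increasing v → f (map h v) ≡ x)

-- Iterates the one-step thinning: after 0 is kept, a homogeneous set h for
-- v ↦ F (0 ∷ map suc v) is what remains, and F pulled back along suc ∘ h is
-- again a colouring of ℕ.  The colour of a tuple of kept points then depends
-- only on its least element.
module PreHomogeneous (ih : (f : Vec ℕ n → A) → Homogeneous f) where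

  thin : (Vec ℕ (suc n) → A) → ℕ → ℕ
  thin F = proj₁ (ih (λ v → F (0 ∷ map suc v)))

  firstColor : (Vec ℕ (suc n) → A) → A
  firstColor F = proj₁ (proj₂ (ih (λ v → F (0 ∷ map suc v))))

  thin-mono : ∀ F → StrictMono (thin F)
  thin-mono F = proj₁ (proj₂ (proj₂ (ih (λ v → F (0 ∷ map suc v)))))

  thin-homogeneous : ∀ F v → Increasing v →
                     F (0 ∷ map suc (map (thin F) v)) ≡ firstColor F
  thin-homogeneous F = proj₂ (proj₂ (proj₂ (ih (λ v → F (0 ∷ map suc v)))))

  next : (Vec ℕ (suc n) → A) → Vec ℕ (suc n) → A
  next F v = F (map suc (map (thin F) v))

  point : (Vec ℕ (suc n) → A) → ℕ → ℕ
  point F zero    = 0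
  point F (suc i) = suc (thin F (point (next F) i))

  color : (Vec ℕ (suc n) → A) → ℕ → A
  color F zero    = firstColor F
  color F (suc i) = color (next F) i

  point-mono : ∀ F → StrictMono (point F)
  point-mono F {zero}  {suc j} _   = z<s
  point-mono F {suc i} {suc j} i<j = s<s (thin-mono F (point-mono (next F) (s<s⁻¹ i<j)))

  map-point-suc : ∀ F (v : Vec ℕ m) →
                  map (point F) (map suc v) ≡ map suc (map (thin F) (map (point (next F)) v))
  map-point-suc F []      = refl
  map-point-suc F (_ ∷ v) = cong (_ ∷_) (map-point-suc F v)

  pullback-suc : {i : ℕ} {v : Vec ℕ m} → All (i <_) v → ∃ λ u → map suc u ≡ v
  pullback-suc = preimage suc ∘ All.map (λ where (s≤s _) → _ , refl)

  -- Entries above `i` are successors. For `i = 0` the tail therefore lies in the thinned set, which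
  -- is homogeneous; for a successor the whole tuple shifts down to one for `next F`.
  color-point : ∀ F i v → Increasing (i ∷ v) → F (map (point F) (i ∷ v)) ≡ color F i
  color-point F i v (i<v ∷ v↗) with u , refl ← pullback-suc i<v with i
  ... | zero = trans
    (cong (λ w → F (0 ∷ w)) (map-point-suc F u))
    (thin-homogeneous F _
      (map-Increasing (point-mono (next F)) (AllPairs.map s<s⁻¹ (map⁻ v↗))))
  ... | suc i = trans
    (cong F (map-point-suc F (i ∷ u)))
    (color-point (next F) i u
      (All.map s<s⁻¹ (All.map⁻ i<v) ∷ AllPairs.map s<s⁻¹ (map⁻ v↗)))

module Classical (em : ExcludedMiddle 0ℓ) where

  InfinitelyOften : Pred ℕ 0ℓ → Set
  InfinitelyOften P = ∀ i → ∃ λ j → i ≤ j × P j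

  eventually-not : {P : Pred ℕ 0ℓ} → ¬ InfinitelyOften P →
                   ∃ λ i → ∀ j → i ≤ j → ¬ P j
  eventually-not {P} ¬inf with em {∃ λ i → ∀ j → i ≤ j → ¬ P j}
  ... | yes ev = ev
  ... | no ¬ev = contradiction inf ¬inf
    where
    inf : InfinitelyOften P
    inf i with em {∃ λ j → i ≤ j × P j}
    ... | yes ex = ex
    ... | no ¬ex = contradiction (i , λ j i≤j pj → ¬ex (j , i≤j , pj)) ¬ev

  enumerate : {P : Pred ℕ 0ℓ} → InfinitelyOften P →
              ∃ λ s → StrictMono s × (∀ i → P (s i))
  enumerate {P} inf =
    proj₁ ∘ s , step⇒StrictMono (λ i → proj₁ (proj₂ (inf (suc (proj₁ (s i)))))) , proj₂ ∘ s
    where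
    s : ℕ → ∃ P
    s zero    with j , _ , pj ← inf 0                   = j , pj
    s (suc i) = proj₁ (inf (suc (proj₁ (s i)))) , proj₂ (proj₂ (inf (suc (proj₁ (s i)))))

  -- Either colour `zero` recurs forever, or it is absent from some `N` on and can be punched out,
  -- leaving one colour fewer.
  pigeonhole : (f : ℕ → Fin c) → ∃₂ λ s x → StrictMono s × (∀ i → f (s i) ≡ x)
  pigeonhole {zero}  f with () ← f 0
  pigeonhole {suc c} f with em {InfinitelyOften (λ i → f i ≡ zero)}
  ... | yes inf with s , s↗ , fs≡0 ← enumerate inf = s , zero , s↗ , fs≡0
  ... | no ¬inf
    with N , f≢0 ← eventually-not ¬inf
    with s , x , s↗ , eq ←
           pigeonhole (λ i → punchOut {i = zero} {f (N + i)} (f≢0 _ (ℕ.m≤m+n N i) ∘ sym))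
    = (N +_) ∘ s , suc x , ℕ.+-monoʳ-< N ∘ s↗ ,
      λ i → trans (sym (Fin.punchIn-punchOut (f≢0 _ (ℕ.m≤m+n N (s i)) ∘ sym)))
                  (cong suc (eq i))

  -- Along `point f` the colour depends only on the least element; the pigeonhole principle then
  -- makes it constant on a subsequence.
  ramsey : (f : Vec ℕ n → Fin c) → Homogeneous f
  ramsey {zero}  f = id , f [] , id , λ where [] [] → refl
  ramsey {suc n} f with s , x , s↗ , eq ← pigeonhole (PreHomogeneous.color (ramsey {n}) f)
    = point f ∘ s , x , point-mono f ∘ s↗ , homogeneous
    where
    open PreHomogeneous (ramsey {n})
    homogeneous : ∀ v → Increasing v → f (map (point f ∘ s) v) ≡ x
    homogeneous (i ∷ v) v↗ = begin
      f (map (point f ∘ s) (i ∷ v))     ≡⟨ cong f (Vec.map-∘ (point f) s (i ∷ v)) ⟩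
      f (map (point f) (map s (i ∷ v))) ≡⟨ color-point f (s i) (map s v) (map-Increasing s↗ v↗) ⟩
      color f (s i)                     ≡⟨ eq i ⟩
      x                                 ∎
      where open ≡-Reasoning

  -- Turns a colouring of the R-sorted vectors into one of arbitrary vectors that
  -- ignores the order of the entries; vectors without an R-sorted rearrangement
  -- get the junk colour d.
  symmetrize : {R : Rel A 0ℓ} → Asymmetric R → Fin c →
               (f : ∀ (u : Vec A n) → AllPairs R u → Fin c) →
               (∀ u p q → f u p ≡ f u q) →
               ∃ λ (g : Vec A n → Fin c) → ∀ u v p → u ~ v → g v ≡ f u p
  symmetrize {A} {c} {n} {R} asym d f irr = g , g-spec
    where
    g : Vec A n → Fin c
    g v with em {∃ λ u → AllPairs R u × u ~ v}
    ... | yes (u , p , _) = f u p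
    ... | no _            = d

    g-spec : ∀ u v p → u ~ v → g v ≡ f u p
    g-spec u v p u~v with em {∃ λ u → AllPairs R u × u ~ v}
    ... | no ¬ex = contradiction (u , p , u~v) ¬ex
    ... | yes (u′ , p′ , u′~v)
      with refl ← sorted-unique asym p′ p (↭-trans u′~v (↭-sym u~v)) = irr u p′ p

  comprehension : (P : Pred (Fin n) 0ℓ) → ∃ λ D → ∀ x → (x FinSubset.∈ D) ⇔ P x
  comprehension P = tabulate χ , λ x → mk⇔
    (λ x∈D → χ⁻ x (trans (sym (Vec.lookup∘tabulate χ x)) (Vec.[]=⇒lookup x∈D)))
    (λ px → Vec.lookup⇒[]= x _ (trans (Vec.lookup∘tabulate χ x) (χ⁺ x px)))
    where
    χ : Fin _ → _
    χ x = does (em {P x})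
    χ⁻ : ∀ x → χ x ≡ true → P x
    χ⁻ x eq with em {P x}
    ... | yes px = px
    χ⁻ x () | no _
    χ⁺ : ∀ x → P x → χ x ≡ true
    χ⁺ x px with em {P x}
    ... | yes _  = refl
    ... | no ¬px = contradiction px ¬px

-- Embeddings of `ω· k` into itself

Ordinal : ℕ → Set
Ordinal k = Fin k × ℕ

infix 4 _≺_

_≺_ : Rel (Ordinal k) 0ℓ
_≺_ {k} = StrictTotalOrder._<_ (ω· k)

≺-asym : Asymmetric (_≺_ {k})
≺-asym {k} = StrictTotalOrder.asym (ω· k)

mono⇒expanding : (f : Fin k → Fin k) → (∀ {i j} → i Fin.< j → f i Fin.< f j) →
                 ∀ i → i Fin.≤ f i
mono⇒expanding {suc k} f mono =
  Fin.<-weakInduction (λ i → i Fin.≤ f i) z≤n λ i ih →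
    ℕ.≤-trans (s≤s (subst (_≤ toℕ (f (inject₁ i))) (Fin.toℕ-inject₁ i) ih))
              (mono (s≤s (ℕ.≤-reflexive (Fin.toℕ-inject₁ i))))

mono⇒contracting : (f : Fin k → Fin k) → (∀ {i j} → i Fin.< j → f i Fin.< f j) →
                   ∀ i → f i Fin.≤ i
mono⇒contracting {suc k} f mono =
  Fin.>-weakInduction (λ i → f i Fin.≤ i) (Fin.≤fromℕ (f (fromℕ k))) λ i ih →
    subst (toℕ (f (inject₁ i)) ≤_) (sym (Fin.toℕ-inject₁ i))
      (s≤s⁻¹ (ℕ.≤-trans (mono {inject₁ i} {suc i} (s≤s (ℕ.≤-reflexive (Fin.toℕ-inject₁ i)))) ih))

mono⇒id : (f : Fin k → Fin k) → (∀ {i j} → i Fin.< j → f i Fin.< f j) → ∀ i → f i ≡ i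
mono⇒id f mono i =
  Fin.toℕ-injective (ℕ.≤-antisym (mono⇒contracting f mono i) (mono⇒expanding f mono i))

module SelfEmbedding (φ : Ordinal k → Ordinal k)
                     (φ-mono : ∀ {x y} → x ≺ y → φ x ≺ φ y) where

  block : Ordinal k → Fin k
  block = proj₁ ∘ φ

  height : Ordinal k → ℕ
  height = proj₂ ∘ φ

  -- One step up a block either sends `φ` to a later block or keeps its block and raises the height.
  -- A block once left is never re-entered.
  climb : ∀ b a i → block (b , a) Fin.< block (b , i + a) ⊎
                    (block (b , a) ≡ block (b , i + a) × i ≤ height (b , i + a))
  climb b a zero    = inj₂ (refl , z≤n)
  climb b a (suc i)
    with climb b a i | φ-mono {b , i + a} {b , suc i + a} (inj₂ (refl , ℕ.n<1+n (i + a)))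
  ... | inj₁ lt         | inj₁ lt′         = inj₁ (ℕ.<-trans lt lt′)
  ... | inj₁ lt         | inj₂ (eq , _)    = inj₁ (ℕ.<-≤-trans lt (Fin.≤-reflexive eq))
  ... | inj₂ (eq , _)   | inj₁ lt′         = inj₁ (ℕ.≤-<-trans (Fin.≤-reflexive eq) lt′)
  ... | inj₂ (eq , i≤h) | inj₂ (eq′ , h<h) = inj₂ (trans eq eq′ , ℕ.≤-<-trans i≤h h<h)

  -- Otherwise the infinitely many φ (b , i + a) would share the block of
  -- φ (b′ , a) and lie below it.
  block-mono : ∀ {b b′} a → b Fin.< b′ → block (b , a) Fin.< block (b′ , a)
  block-mono {b} {b′} a b<b′ with climb b a (height (b′ , a))
                                | φ-mono {b , height (b′ , a) + a} {b′ , a} (inj₁ b<b′)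
  ... | inj₁ lt        | inj₁ lt′       = ℕ.<-trans lt lt′
  ... | inj₁ lt        | inj₂ (eq , _)  = ℕ.<-≤-trans lt (Fin.≤-reflexive eq)
  ... | inj₂ (eq , _)  | inj₁ lt′       = ℕ.≤-<-trans (Fin.≤-reflexive eq) lt′
  ... | inj₂ (_ , i≤h) | inj₂ (_ , h<i) = contradiction i≤h (ℕ.<⇒≱ h<i)

  block-id : ∀ b a → block (b , a) ≡ b
  block-id b a = mono⇒id (λ b → block (b , a)) (block-mono a) b

  height-expanding : ∀ b a → a ≤ height (b , a)
  height-expanding b zero    = z≤n
  height-expanding b (suc a) with φ-mono {b , a} {b , suc a} (inj₂ (refl , ℕ.n<1+n a))
  -- `block-id` forbids a change of block, so the height must rise.
  ... | inj₁ lt       = contradiction (trans (block-id b a) (sym (block-id b (suc a)))) (Fin.<⇒≢ lt)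
  ... | inj₂ (_ , lt) = ℕ.≤-<-trans (height-expanding b a) lt

  -- The letter `b` is realized by `φ (b , l)`, whose height is at least `l`; restarting just above
  -- that height keeps the second coordinates increasing.
  realize : (w : Vec (Fin k) n) (l : ℕ) →
            Σ[ v ∈ Vec (Ordinal k) n ]
              map proj₁ v ≡ w × All (λ x → l ≤ proj₂ x) v ×
              AllPairs (_<_ on proj₂) v × All (λ x → ∃ λ y → φ y ≡ x) v
  realize []      l = [] , refl , [] , [] , []
  realize (b ∷ w) l
    with v , blocks , above , v↗ , inRange ← realize w (suc (height (b , l)))
    = φ (b , l) ∷ v , cong₂ _∷_ (block-id b l) blocks ,
      height-expanding b l ∷ All.map (λ h<x → ℕ.≤-trans (height-expanding b l) (ℕ.<⇒≤ h<x)) above ,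
      above ∷ v↗ , ((b , l) , refl) ∷ inRange

sort-≺ : {v : Vec (Ordinal k) n} → AllPairs _≢_ v →
         Σ[ u ∈ Vec (Ordinal k) n ] u ~ v × AllPairs _≺_ u
sort-≺ {k} v≢ = Sorting.sort (ω· k) _ (AllPairs.map (_∘ ≡×≡⇒≡) v≢)

-- A copy of `ω· k` with distinct second coordinates

module SpreadOut {h : ℕ → ℕ} (h-mono : StrictMono h) where

  -- Numbers the points row by row: the `k` points at height `j` take the numbers from `j * k` up to
  -- `suc j * k`, exclusive.
  index : Ordinal k → ℕ
  index {k} (b , j) = toℕ b + j * k

  index-mono : {x y : Ordinal k} → proj₂ x < proj₂ y → index x < index y
  index-mono {k} {b , j} {b′ , j′} j<j′ = begin-strict
    toℕ b + j * k   <⟨ ℕ.+-monoˡ-< (j * k) (Fin.toℕ<n b) ⟩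
    suc j * k       ≤⟨ ℕ.*-monoˡ-≤ k j<j′ ⟩
    j′ * k          ≤⟨ ℕ.m≤n+m (j′ * k) (toℕ b′) ⟩
    toℕ b′ + j′ * k ∎
    where open ℕ.≤-Reasoning

  index-injective : {x y : Ordinal k} → index x ≡ index y → x ≡ y
  index-injective {k} {b , j} {b′ , j′} eq with ℕ.<-cmp j j′
  ... | tri< j<j′ _ _ = contradiction eq (ℕ.<⇒≢ (index-mono {x = b , j} {b′ , j′} j<j′))
  ... | tri≈ _ refl _ =
    cong (_, j) (Fin.toℕ-injective (ℕ.+-cancelʳ-≡ (j * k) (toℕ b) (toℕ b′) eq))
  ... | tri> _ _ j′<j = contradiction (sym eq) (ℕ.<⇒≢ (index-mono {x = b′ , j′} {b , j} j′<j))

  spread : Ordinal k → Ordinal k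
  spread x = proj₁ x , h (index x)

  spread-mono : {x y : Ordinal k} → x ≺ y → spread x ≺ spread y
  spread-mono (inj₁ b<b′) = inj₁ b<b′
  spread-mono {x = x} {y} (inj₂ (b≡b′ , j<j′)) =
    inj₂ (b≡b′ , h-mono (index-mono {x = x} {y} j<j′))

  spread-cancel : {x y : Ordinal k} → spread x ≺ spread y → x ≺ y
  spread-cancel {k} {x} {y} lt with StrictTotalOrder.compare (ω· k) x y
  ... | tri< x≺y _ _ = x≺y
  ... | tri≈ _ x≈y _ with refl ← ≡×≡⇒≡ x≈y =
    contradiction lt (StrictTotalOrder.irrefl (ω· k) {spread x} (refl , refl))
  spread-cancel {k} {x} {y} lt | tri> _ _ y≺x =
    contradiction lt (≺-asym {x = spread y} (spread-mono {x = y} {x} y≺x))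

  spread-injective : {x y : Ordinal k} → spread x ≡ spread y → x ≡ y
  spread-injective {k} {x} {y} eq with StrictTotalOrder.compare (ω· k) x y
  ... | tri< x≺y _ _ = contradiction (spread-mono {x = x} {y} x≺y)
    (StrictTotalOrder.irrefl (ω· k) (≡⇒≡×≡ eq))
  ... | tri≈ _ x≈y _ = ≡×≡⇒≡ x≈y
  ... | tri> _ _ y≺x = contradiction (spread-mono {x = y} {x} y≺x)
    (StrictTotalOrder.irrefl (ω· k) (≡⇒≡×≡ (sym eq)))

  range : (k : ℕ) → Subset (ω· k)
  range k = record
    { member   = λ x → ∃ λ y → spread y ≡ x
    ; respects = λ x≈y → subst (λ x → ∃ λ y → spread y ≡ x) (≡×≡⇒≡ x≈y)
    }

  -- A membership proof contains the preimage under `spread`, and projecting to it is the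
  -- isomorphism.
  range≅ : (k : ℕ) → restrict (ω· k) (range k) ≅ ω· k
  range≅ k = (λ x → proj₁ (proj₂ x)) , record
    { isOrderMonomorphism = record
      { isOrderHomomorphism = record
        { cong = λ {x} {y} → preserves x y
        ; mono = λ {x} {y} → preserves-≺ x y
        }
      ; injective = λ {x} {y} → reflects x y
      ; cancel    = λ {x} {y} → reflects-≺ x y
      }
    ; surjective = λ y → (spread y , y , refl) , λ {z} → preserves z (spread y , y , refl)
    }
    where
    open StrictTotalOrder (ω· k) using (_≈_)
    Range = ∃ (Subset.member (range k))
    preserves : (x y : Range) → proj₁ x ≈ proj₁ y → proj₁ (proj₂ x) ≈ proj₁ (proj₂ y)
    preserves (_ , _ , refl) (_ , _ , refl) eq = ≡⇒≡×≡ (spread-injective (≡×≡⇒≡ eq))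
    preserves-≺ : (x y : Range) → proj₁ x ≺ proj₁ y → proj₁ (proj₂ x) ≺ proj₁ (proj₂ y)
    preserves-≺ (_ , x , refl) (_ , y , refl) = spread-cancel {x = x} {y}
    reflects : (x y : Range) → proj₁ (proj₂ x) ≈ proj₁ (proj₂ y) → proj₁ x ≈ proj₁ y
    reflects (_ , _ , refl) (_ , _ , refl) eq = ≡⇒≡×≡ (cong spread (≡×≡⇒≡ eq))
    reflects-≺ : (x y : Range) → proj₁ (proj₂ x) ≺ proj₁ (proj₂ y) → proj₁ x ≺ proj₁ y
    reflects-≺ (_ , x , refl) (_ , y , refl) = spread-mono {x = x} {y}

  sort-by-index : {v : Vec (Ordinal k) n} → AllPairs _≢_ v →
                  Σ[ u ∈ Vec (Ordinal k) n ] u ~ v × AllPairs (_<_ on index) u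
  sort-by-index v≢ = Sorting.sort (On.strictTotalOrder ℕ.<-strictTotalOrder index) _
    (AllPairs.map (_∘ index-injective) v≢)

  -- Puts a set of spread points into the form, word and heights, to which homogeneity applies.
  map-spread : (v : Vec (Ordinal k) n) →
               map spread v ≡ zip (map proj₁ v) (map h (map index v))
  map-spread []      = refl
  map-spread (x ∷ v) = cong (spread x ∷_) (map-spread v)

-- The two bounds

module Bounds (em : ExcludedMiddle 0ℓ) where
  open Classical em

  coloring-irrelevant : (COL : Coloring (ω· k) n c) → ∀ u p q →
                        Func.to COL (u , p) ≡ Func.to COL (u , q)
  coloring-irrelevant COL u p q = Func.cong COL {u , p} {u , q} (Pointwise.refl (refl , refl))

  upperBound : (n k : ℕ) → Bound (ω· k) n (k ^ n)
  upperBound n k (suc c) _ COL =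
    range k , range≅ k , D , D-spec ,
    ℕ.≤-trans (FinSubset.p⊆q⇒∣p∣≤∣q∣ D⊆image) (∣image∣≤ wordColor)
    where
    -- The junk colour `zero` exists because there is at least one colour; it is given only to
    -- vectors with a repeated point.
    symmetrized = symmetrize ≺-asym zero (λ u p → Func.to COL (u , p)) (coloring-irrelevant COL)
    g : Vec (Ordinal k) n → Fin (suc c)
    g = proj₁ symmetrized

    -- The whole function from words to colours is coded as a single colour, so one use of Ramsey's
    -- theorem treats all words at once.
    profile : Vec ℕ n → Fin (suc c ^ (k ^ n))
    profile X = funToFin (λ w → g (zip (decode {k} w) X))

    homogeneous : Homogeneous profile
    homogeneous = ramsey profile
    h = proj₁ homogeneous
    open SpreadOut {h} (proj₁ (proj₂ (proj₂ homogeneous)))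

    wordColor : Fin (k ^ n) → Fin (suc c)
    wordColor = finToFun (proj₁ (proj₂ homogeneous))

    g-zip : ∀ w X → Increasing X → g (zip (decode w) (map h X)) ≡ wordColor w
    g-zip w X X↗ = trans
      (sym (Fin.finToFun-funToFin (λ w → g (zip (decode {k} w) (map h X))) w))
      (cong (λ p → finToFun p w) (proj₂ (proj₂ (proj₂ homogeneous)) X X↗))

    D = proj₁ (comprehension (Attained (ω· k) COL (range k)))
    D-spec = proj₂ (comprehension (Attained (ω· k) COL (range k)))

    attained⇒wordColor : ∀ {x} → Attained (ω· k) COL (range k) x → ∃ λ w → wordColor w ≡ x
    attained⇒wordColor ((v , v↗) , inRange , refl)
      with u , refl ← preimage spread inRange
      -- Homogeneity speaks of increasing second coordinates, so the word is read in index order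
      -- rather than in the order `_≺_`.
      with s , s~u , s↗ ← sort-by-index
             (irrefl⇒distinct (λ {x} lt → ≺-asym {x = spread x} lt lt) (map⁻ v↗))
      = encode (map proj₁ s) , (begin
        wordColor (encode (map proj₁ s))
          ≡⟨ g-zip _ (map index s) (AllPairs.map⁺ s↗) ⟨
        g (zip (decode (encode (map proj₁ s))) (map h (map index s)))
          ≡⟨ cong (λ w → g (zip w (map h (map index s)))) (decode∘encode (map proj₁ s)) ⟩
        g (zip (map proj₁ s) (map h (map index s)))
          ≡⟨ cong g (map-spread s) ⟨
        g (map spread s)
          ≡⟨ proj₂ symmetrized _ _ v↗ (↭-sym (map-~ spread {s} {u} s~u)) ⟩
        Func.to COL (map spread u , v↗)
          ∎)
      where open ≡-Reasoning

    D⊆image : D ⊆ image wordColor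
    D⊆image {x} x∈D with w , refl ← attained⇒wordColor (Equivalence.to (D-spec x) x∈D) =
      ∈-image wordColor w

  Attains-all : (COL : Coloring (ω· k) n c) → Set₁
  Attains-all {k} COL = ∀ S′ → restrict (ω· k) S′ ≅ ω· k → ∀ x → Attained (ω· k) COL S′ x

  -- An n-set is coloured by the word of blocks met when its elements are listed
  -- by increasing second coordinate; the colour d is used only for sets with a
  -- repeated second coordinate.
  wordColoring : (n k : ℕ) → Fin (k ^ n) →
                 ∃ λ (COL : Coloring (ω· k) n (k ^ n)) → Attains-all COL
  wordColoring n k d = COL , attains
    where
    symmetrized = symmetrize {R = _<_ on proj₂} (λ {x} {y} → ℕ.<-asym {proj₂ x} {proj₂ y}) d
      (λ (u : Vec (Ordinal k) n) _ → encode (map proj₁ u)) (λ _ _ _ → refl)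
    g = proj₁ symmetrized

    COL : Coloring (ω· k) n (k ^ n)
    COL = record
      { to   = g ∘ proj₁
      ; cong = cong g ∘ Pointwise-≡⇒≡ ∘ Pointwise.map ≡×≡⇒≡
      }

    attains : Attains-all COL
    attains S′ (f , iso) x = (u , u↗) , u∈S′ , (begin
      g u                       ≡⟨ proj₂ symmetrized v u v↗ (↭-sym u~v) ⟩
      encode (map proj₁ v)      ≡⟨ cong encode blocks ⟩
      encode (decode {k} {n} x) ≡⟨ encode∘decode {k} {n} x ⟩
      x                         ∎)
      where
      open ≡-Reasoning
      module iso = IsOrderIsomorphism iso
      module R = StrictTotalOrder (restrict (ω· k) S′)
      f⁻¹ : Ordinal k → R.Carrier
      f⁻¹ y = proj₁ (iso.surjective y)
      f∘f⁻¹ : ∀ y → f (f⁻¹ y) ≡ y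
      f∘f⁻¹ y = ≡×≡⇒≡ (proj₂ (iso.surjective y) {f⁻¹ y} (R.Eq.refl {f⁻¹ y}))
      -- The inverse isomorphism followed by the inclusion of the copy embeds `ω· k` into itself.
      open SelfEmbedding (proj₁ ∘ f⁻¹) (λ {y} {z} y≺z → iso.cancel {f⁻¹ y} {f⁻¹ z}
        (subst₂ _≺_ (sym (f∘f⁻¹ y)) (sym (f∘f⁻¹ z)) y≺z))

      realized = realize (decode {k} {n} x) 0
      v = proj₁ realized
      blocks = proj₁ (proj₂ realized)
      v↗ = proj₁ (proj₂ (proj₂ (proj₂ realized)))
      inRange = proj₂ (proj₂ (proj₂ (proj₂ realized)))
      -- Increasing heights make the points distinct, so they can be relisted in the order `_≺_`;
      -- `g` does not see the change.
      sorted = sort-≺ (irrefl⇒distinct {R = _<_ on proj₂} (ℕ.<-irrefl refl) v↗)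
      u = proj₁ sorted
      u~v = proj₁ (proj₂ sorted)
      u↗ = proj₂ (proj₂ sorted)
      u∈S′ : All (Subset.member S′) u
      u∈S′ = All-resp-~ {u = v} {v = u} (↭-sym u~v)
        (All.map (λ where (y , refl) → proj₂ (f⁻¹ y)) inRange)

  lowerBound : (n k t : ℕ) → Bound (ω· k) n t → k ^ n ≤ t
  lowerBound n k t bound with 1 ℕ.≤? k ^ n
  -- Here `k ^ n` is `0`: no colour is available, and none is required.
  ... | no  c≮1 = ℕ.≤-trans (s≤s⁻¹ (ℕ.≰⇒> c≮1)) z≤n
  ... | yes 1≤c
    with COL , attains-all ← wordColoring n k (Fin.fromℕ< 1≤c)
    with S′ , S′≅ , D , D-spec , ∣D∣≤t ← bound (k ^ n) 1≤c COL = begin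
      k ^ n            ≡⟨ FinSubset.∣⊤∣≡n (k ^ n) ⟨
      card (⊤ {k ^ n}) ≤⟨ FinSubset.p⊆q⇒∣p∣≤∣q∣ {p = ⊤ {k ^ n}} (λ {x} _ →
                            Equivalence.from (D-spec x) (attains-all S′ S′≅ x)) ⟩
      card D           ≤⟨ ∣D∣≤t ⟩
      t                ∎
    where open ℕ.≤-Reasoning

  leastBound : (n k : ℕ) → LeastBound (ω· k) n (k ^ n)
  leastBound n k = upperBound n k , lowerBound n k

-- `T` returns whichever least bound `em` supplies; any two are equal by antisymmetry.
leastBound⇒T : (em : ExcludedMiddle (lsuc 0ℓ)) {S : LinearOrder} {t : ℕ} →
               LeastBound S n t → T em n S ≡ [ t ]
leastBound⇒T {n} em {S} {t} least with em {∃ (LeastBound S n)}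
... | yes (u , bound-u , u-least) =
  cong [_] (ℕ.≤-antisym (u-least t (proj₁ least)) (proj₂ least u bound-u))
... | no ¬ex = contradiction (t , least) ¬ex

theorem5p2 : (em : ExcludedMiddle (lsuc 0ℓ)) → (n k : ℕ) →
    ([ k ^ n ] ≤∞ T em n (ω· k)) × (T em n (ω· k) ≡ [ k ^ n ])
theorem5p2 em n k =
  subst ([ k ^ n ] ≤∞_) (sym T≡kⁿ) AddSupremum.[ ℕ.≤-refl ] , T≡kⁿ
  where
  -- Excluded middle for small propositions follows by lifting them one universe level.
  T≡kⁿ = leastBound⇒T em (Bounds.leastBound (map′ lower lift em) n k)
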